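{- Let $\{g_{n}^{(3)}(a,b,c;1)\}_{n=0}^{\infty}$ be the geometric mean sequence with initial values $g_{0}^{(3)}=a$, $g_{1}^{(3)}=b$, $g_{2}^{(3)}=c$, defined by the recurrence $g_{n+3}^{(3)}=\sqrt[3]{g_{n+2}^{(3)}g_{n+1}^{(3)}g_{n}^{(3)}}$ for $n\geq 0$. Then the sequence grows according to $$\lim_{n\rightarrow \infty}\frac{g_{n+1}^{(3)}(a,b,c;1)}{g_{n}^{(3)}(a,b,c;1)}=1.$$
   Context: The (scaled) geometric mean sequence $\{g_{n}^{(3)}(a,b,c;\epsilon)\}_{n=0}^{\infty}$ is defined, given $g_{0}^{(3)}=a$, $g_{1}^{(3)}=b$ and $g_{2}^{(3)}=c$, through the recurrence $g_{n+3}^{(3)}=\epsilon\sqrt[3]{g_{n+2}^{(3)}g_{n+1}^{(3)}g_{n}^{(3)}}$, $n\geq 0$, where $\epsilon\in\mathbb{N}$ is a scaling constant. The last argument $1$ in $g_{n}^{(3)}(a,b,c;1)$ means that $\epsilon=1$. The initial values are denoted $a,b,c$, with no further condition stated on them.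
   Formalization: The initial values a, b, c are taken to be positive reals: with a zero the ratios become 0/0, and for (-1,1,1) with real cube roots they change sign forever, so the limit fails. The all-negative case follows by changing the sign of the sequence. -}

module Defs where

open import Data.Integer.Base as ℤ using (+_)
import Data.Integer.Properties as ℤ
open import Data.Nat.Base as ℕ using (ℕ; zero; suc)
open import Data.Product using (∃; ∃₂; _×_; _,_)
open import Data.Rational
open import Data.Rational.Properties
open import Data.Rational.Solver using (module +-*-Solver)
open import Data.Rational.Unnormalised.Base as ℚᵘ using (mkℚᵘ)
import Data.Rational.Unnormalised.Properties as ℚᵘ
open import Data.Sum using (_⊎_; inj₁; inj₂; [_,_]′)
open import Function.Base using (case_of_)
open import Relation.Binary.Definitions using (tri<; tri≈; tri>)
open import Relation.Binary.PropositionalEquality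
open import Relation.Nullary using (yes; no; contradiction)

*ʳ-< : ∀ {p q r} → 0ℚ < r → p < q → p * r < q * r
*ʳ-< {r = r} 0<r = *-monoˡ-<-pos r {{positive 0<r}}

*ˡ-< : ∀ {p q r} → 0ℚ < r → p < q → r * p < r * q
*ˡ-< {r = r} 0<r = *-monoʳ-<-pos r {{positive 0<r}}

*-cancelʳ-< : ∀ {p q r} → 0ℚ < r → p * r < q * r → p < q
*-cancelʳ-< {r = r} 0<r = *-cancelʳ-<-nonNeg r {{pos⇒nonNeg r {{positive 0<r}}}}

*-pos : ∀ {p q} → 0ℚ < p → 0ℚ < q → 0ℚ < p * q
*-pos {p} {q} 0<p 0<q = subst (_< p * q) (*-zeroˡ q) (*ʳ-< 0<q 0<p)

*-mono-< : ∀ {p q r s} → 0ℚ < r → 0ℚ < q → p < q → r < s → p * r < q * s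
*-mono-< 0<r 0<q p<q r<s = <-trans (*ʳ-< 0<r p<q) (*ˡ-< 0<q r<s)

abstract

  reciprocal : ∀ {p} → 0ℚ < p → ∃ λ r → 0ℚ < r × r * p ≡ 1ℚ
  reciprocal {p} 0<p =
    (1/ p) {{nz}} , positive⁻¹ _ {{1/pos⇒pos p {{positive 0<p}}}} , *-inverseˡ p {{nz}}
    where
    nz : NonZero p
    nz = >-nonZero 0<p

  quotient : ∀ {p} a → 0ℚ < p → ∃ λ r → r * p ≡ a
  quotient {p} a 0<p with reciprocal 0<p
  ... | r , _ , rp≡1 =
    a * r , trans (*-assoc a r p) (trans (cong (a *_) rp≡1) (*-identityʳ a))

  -- a / c < t < b / d
  between : ∀ {a b c d} → 0ℚ < c → 0ℚ < d → a * d < b * c →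
            ∃ λ t → a < t * c × t * d < b
  between {a} {b} {c} {d} 0<c 0<d ad<bc
    with quotient a 0<c | quotient b 0<d
  ... | x , refl | y , refl with <-dense x<y
    where
    x<y : x < y
    x<y = *-cancelʳ-< (*-pos 0<c 0<d)
      (subst₂ _<_ (*-assoc x c d)
        (trans (*-assoc y d c) (cong (y *_) (*-comm d c))) ad<bc)
  ... | t , x<t , t<y = t , *ʳ-< 0<c x<t , *ʳ-< 0<d t<y

  raise : ∀ {a b d} → 0ℚ < d → a * d < b → ∃ λ t → a < t × t * d < b
  raise {a} {b} {d} 0<d ad<b
    with between {a} {b} {1ℚ} {d} (positive⁻¹ 1ℚ) 0<d
           (subst (a * d <_) (sym (*-identityʳ b)) ad<b)
  ... | t , a<t1 , td<b = t , subst (a <_) (*-identityʳ t) a<t1 , td<b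

  reduce : ∀ {a b c} → 0ℚ < c → a < b * c → ∃ λ t → t < b × a < t * c
  reduce {a} {b} {c} 0<c a<bc
    with between {a} {b} {c} {1ℚ} 0<c (positive⁻¹ 1ℚ)
           (subst (_< b * c) (sym (*-identityʳ a)) a<bc)
  ... | t , a<tc , t1<b = t , subst (_< b) (*-identityʳ t) t1<b , a<tc

cube : ℚ → ℚ
cube q = q * q * q

cube-mono-< : ∀ {p q} → 0ℚ < p → p < q → cube p < cube q
cube-mono-< 0<p p<q =
  *-mono-< 0<p (*-pos 0<q 0<q) (*-mono-< 0<p 0<q p<q p<q) p<q
  where 0<q = <-trans 0<p p<q

cube-cancel-< : ∀ {p q} → 0ℚ < q → cube p < cube q → p < q
cube-cancel-< {p} {q} 0<q p³<q³ with <-cmp p q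
... | tri< p<q _ _ = p<q
... | tri≈ _ refl _ = contradiction p³<q³ (<-irrefl refl)
... | tri> _ _ q<p = contradiction (cube-mono-< 0<q q<p) (<-asym p³<q³)

p<p+1 : ∀ p → p < p + 1ℚ
p<p+1 p = subst (_< p + 1ℚ) (+-identityʳ p) (+-monoʳ-< p (positive⁻¹ 1ℚ))

p<cube[p+1] : ∀ {p} → 0ℚ < p → p < cube (p + 1ℚ)
p<cube[p+1] {p} 0<p = <-trans (p<p+1 p) (<-trans
    (subst (_< s * s) (*-identityʳ s) (*ˡ-< 0<s 1<s))
    (subst (_< s * s * s) (*-identityʳ (s * s)) (*ˡ-< (*-pos 0<s 0<s) 1<s)))
  where
  s = p + 1ℚ
  0<s : 0ℚ < s
  0<s = <-trans 0<p (p<p+1 p)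
  1<s : 1ℚ < s
  1<s = subst (_< s) (+-identityˡ 1ℚ) (+-monoˡ-< 1ℚ 0<p)

cube[p]<p : ∀ {p} → 0ℚ < p → p < 1ℚ → cube p < p
cube[p]<p {p} 0<p p<1 = <-trans
  (subst (p * p * p <_) (*-identityʳ (p * p)) (*ˡ-< (*-pos 0<p 0<p) p<1))
  (subst (p * p <_) (*-identityʳ p) (*ˡ-< 0<p p<1))

cube[½]<1 : cube ½ < 1ℚ
cube[½]<1 = *<* (ℤ.+<+ (ℕ.s≤s (ℕ.s≤s ℕ.z≤n)))

infixl 7 _·_
_·_ : ℕ → ℚ → ℚ
zero  · δ = 0ℚ
suc n · δ = δ + n · δ

·1-toℚᵘ : ∀ n → toℚᵘ (n · 1ℚ) ℚᵘ.≃ mkℚᵘ (+ n) 0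
·1-toℚᵘ zero    = ℚᵘ.≃-refl
·1-toℚᵘ (suc n) = ℚᵘ.≃-trans (toℚᵘ-homo-+ 1ℚ (n · 1ℚ))
  (ℚᵘ.≃-trans (ℚᵘ.+-congʳ (toℚᵘ 1ℚ) (·1-toℚᵘ n))
    (ℚᵘ.*≡* (cong (λ k → k ℤ.* + 1) (cong (λ k → + 1 ℤ.+ k) (ℤ.*-identityʳ (+ n))))))

·1-* : ∀ n δ → n · 1ℚ * δ ≡ n · δ
·1-* zero    δ = *-zeroˡ δ
·1-* (suc n) δ = trans (*-distribʳ-+ δ 1ℚ (n · 1ℚ)) (cong₂ _+_ (*-identityˡ δ) (·1-* n δ))

≤-·1 : ∀ p → ∃ λ n → p ≤ n · 1ℚ
≤-·1 p@(mkℚ num d-1 _) = ℤ.∣ num ∣ ,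
  toℚᵘ-cancel-≤ (ℚᵘ.≤-respʳ-≃ (ℚᵘ.≃-sym (·1-toℚᵘ ℤ.∣ num ∣)) (ℚᵘ.*≤* (lem num)))
  where
  lem : ∀ i → i ℤ.* + 1 ℤ.≤ + ℤ.∣ i ∣ ℤ.* + suc d-1
  lem (+ n)        = ℤ.*-monoˡ-≤-nonNeg (+ n) (ℤ.+≤+ (ℕ.s≤s ℕ.z≤n))
  lem (ℤ.-[1+ n ]) = ℤ.-≤+

abstract

  archimedean : ∀ {δ} p → 0ℚ < δ → ∃ λ n → p ≤ n · δ
  archimedean {δ} p 0<δ with quotient p 0<δ
  ... | w , refl with ≤-·1 w
  ... | n , w≤n = n , subst (w * δ ≤_) (·1-* n δ)
    (*-monoʳ-≤-nonNeg δ {{pos⇒nonNeg δ {{positive 0<δ}}}} w≤n)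

-‿+-cancel : ∀ p q → p - q + q ≡ p
-‿+-cancel = solve 2 (λ p q → p :- q :+ q := p) refl
  where open +-*-Solver

+-‿-cancel : ∀ p q → p + q - q ≡ p
+-‿-cancel = solve 2 (λ p q → p :+ q :- q := p) refl
  where open +-*-Solver

-- Dedekind cuts of ℚ.  `Lower x q` is read q < x and `Upper x q` is
-- read x < q.

record ℝ : Set₁ where
  field
    Lower Upper : ℚ → Set
    lower-inhabited : ∃ Lower
    upper-inhabited : ∃ Upper
    lower-closed    : ∀ {p q} → p < q → Lower q → Lower p
    upper-closed    : ∀ {p q} → p < q → Upper p → Upper q
    lower-open      : ∀ {p} → Lower p → ∃ λ q → p < q × Lower q
    upper-open      : ∀ {q} → Upper q → ∃ λ p → p < q × Upper p
    separated       : ∀ {p q} → Lower p → Upper q → p < q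
    located         : ∀ {p q} → p < q → Lower p ⊎ Upper q

open ℝ

fromℚ : ℚ → ℝ
fromℚ r .Lower q = q < r
fromℚ r .Upper q = r < q
fromℚ r .lower-inhabited = r - 1ℚ ,
  subst (r - 1ℚ <_) (+-identityʳ r) (+-monoʳ-< r (negative⁻¹ (- 1ℚ)))
fromℚ r .upper-inhabited = r + 1ℚ ,
  subst (_< r + 1ℚ) (+-identityʳ r) (+-monoʳ-< r (positive⁻¹ 1ℚ))
fromℚ r .lower-closed p<q q<r = <-trans p<q q<r
fromℚ r .upper-closed p<q r<p = <-trans r<p p<q
fromℚ r .lower-open = <-dense
fromℚ r .upper-open r<q with <-dense r<q
... | p , r<p , p<q = p , p<q , r<p
fromℚ r .separated = <-trans
fromℚ r .located {p} {q} p<q with p <? r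
... | yes p<r = inj₁ p<r
... | no  p≮r = inj₂ (≤-<-trans (≮⇒≥ p≮r) p<q)

1ℝ : ℝ
1ℝ = fromℚ 1ℚ

infix 4 _<ℝ_

_<ℝ_ : ℝ → ℝ → Set
x <ℝ y = ∃ λ q → Upper x q × Lower y q

infixl 6 _+ℚ_

_+ℚ_ : ℝ → ℚ → ℝ
(x +ℚ r) .Lower q = Lower x (q - r)
(x +ℚ r) .Upper q = Upper x (q - r)
(x +ℚ r) .lower-inhabited with lower-inhabited x
... | q , l = q + r , subst (Lower x) (sym (+-‿-cancel q r)) l
(x +ℚ r) .upper-inhabited with upper-inhabited x
... | q , u = q + r , subst (Upper x) (sym (+-‿-cancel q r)) u
(x +ℚ r) .lower-closed p<q = lower-closed x (+-monoˡ-< (- r) p<q)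
(x +ℚ r) .upper-closed p<q = upper-closed x (+-monoˡ-< (- r) p<q)
(x +ℚ r) .lower-open {p} l with lower-open x l
... | q , p-r<q , l′ = q + r
  , subst (_< q + r) (-‿+-cancel p r) (+-monoˡ-< r p-r<q)
  , subst (Lower x) (sym (+-‿-cancel q r)) l′
(x +ℚ r) .upper-open {q} u with upper-open x u
... | p , p<q-r , u′ = p + r
  , subst (p + r <_) (-‿+-cancel q r) (+-monoˡ-< r p<q-r)
  , subst (Upper x) (sym (+-‿-cancel p r)) u′
(x +ℚ r) .separated {p} {q} l u =
  subst₂ _<_ (-‿+-cancel p r) (-‿+-cancel q r) (+-monoˡ-< r (separated x l u))
(x +ℚ r) .located p<q = located x (+-monoˡ-< (- r) p<q)

-- ∣ x - y ∣ < ε, unfolded to x < y + ε and y < x + ε.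

∣_-_∣<_ : ℝ → ℝ → ℚ → Set
∣ x - y ∣< ε = x <ℝ y +ℚ ε × y <ℝ x +ℚ ε

-- Rational ε suffice, since every positive real exceeds a positive
-- rational.

infix 4 lim_≈_

lim_≈_ : (ℕ → ℝ) → ℝ → Set
lim s ≈ ℓ = ∀ ε → 0ℚ < ε → ∃ λ N → ∀ n → N ℕ.≤ n → ∣ s n - ℓ ∣< ε

record ℝ⁺ : Set₁ where
  field
    real   : ℝ
    0<real : Lower real 0ℚ

open ℝ⁺ public using (real)

module L⁺ (x : ℝ⁺) where

  open ℝ⁺ x using () renaming (real to ξ; 0<real to 0<ξ)

  lower⁺ : ∃ λ r → 0ℚ < r × Lower ξ r
  lower⁺ = lower-open ξ 0<ξ

  upper⁺ : ∀ {u} → Upper ξ u → 0ℚ < u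
  upper⁺ = separated ξ 0<ξ

  abstract

    walk : ∀ {δ r} n → 0ℚ < r → 0ℚ < δ → Lower ξ r → Upper ξ (r + n · δ) →
           ∀ {r₀} → r₀ ≤ r →
           ∃ λ s → r₀ ≤ s × Lower ξ s × Upper ξ (s + δ + δ)
    walk {δ} {r} zero 0<r 0<δ l u r₀≤r =
      contradiction (separated ξ l u) (<-irrefl (sym (+-identityʳ r)))
    walk {δ} {r} (suc n) 0<r 0<δ l u {r₀} r₀≤r
      with located ξ {r + δ} {r + δ + δ}
             (subst (_< r + δ + δ) (+-identityʳ (r + δ)) (+-monoʳ-< (r + δ) 0<δ))
    ... | inj₂ u′ = r , r₀≤r , l , u′
    ... | inj₁ l′ = walk n (<-trans 0<r r<r+δ) 0<δ l′
                      (subst (Upper ξ) (sym (+-assoc r δ (n · δ))) u)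
                      (≤-trans r₀≤r (<⇒≤ r<r+δ))
      where
      r<r+δ : r < r + δ
      r<r+δ = subst (_< r + δ) (+-identityʳ r) (+-monoʳ-< r 0<δ)

    -- r < x < u and u / r < q / p
    approx : ∀ {p q} → 0ℚ < p → p < q →
             ∃₂ λ r u → 0ℚ < r × Lower ξ r × Upper ξ u × u * p < r * q
    approx {p} {q} 0<p p<q =
      let (r₀ , 0<r₀ , l₀) = lower⁺
          (u₀ , v₀) = upper-inhabited ξ
          0<q-p = subst (_< q - p) (+-inverseʳ p) (+-monoˡ-< (- p) p<q)
          0<2p = +-mono-< 0<p 0<p
          (δ , 0<δ , δ2p<) = raise {0ℚ} {r₀ * (q - p)} {p + p} 0<2p
            (subst (_< r₀ * (q - p)) (sym (*-zeroˡ (p + p))) (*-pos 0<r₀ 0<q-p))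
          (n , u₀≤nδ) = archimedean u₀ 0<δ
          u₀<r₀+nδ = subst (_< r₀ + n · δ) (+-identityˡ u₀) (+-mono-<-≤ 0<r₀ u₀≤nδ)
          (s , r₀≤s , l , u) = walk n 0<r₀ 0<δ l₀ (upper-closed ξ u₀<r₀+nδ v₀) ≤-refl
      in s , s + δ + δ , <-≤-trans 0<r₀ r₀≤s , l , u ,
         subst₂ _<_ (expand s δ p) (collect s p q)
           (+-monoʳ-< (s * p) (<-≤-trans δ2p<
             (*-monoʳ-≤-nonNeg (q - p) {{nonNegative (<⇒≤ 0<q-p)}} r₀≤s)))
      where
      open +-*-Solver
      expand : ∀ s δ p → s * p + δ * (p + p) ≡ (s + δ + δ) * p
      expand = solve 3 (λ s δ p → s :* p :+ δ :* (p :+ p) := (s :+ δ :+ δ) :* p) refl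
      collect : ∀ s p q → s * p + s * (q - p) ≡ s * q
      collect = solve 3 (λ s p q → s :* p :+ s :* (q :- p) := s :* q) refl

open L⁺

fromℕ⁺ : (n : ℕ) .{{_ : ℕ.NonZero n}} → ℝ⁺
fromℕ⁺ n .ℝ⁺.real   = fromℚ (+ n / 1)
fromℕ⁺ n .ℝ⁺.0<real = positive⁻¹ (+ n / 1) {{normalize-pos n 1}}

infixl 7 _*⁺_ _÷⁺_
infix  8 ∛_ _⁻¹

_*⁺_ : ℝ⁺ → ℝ⁺ → ℝ⁺
x *⁺ y = record
  { real = record
    { Lower           = L
    ; Upper           = U
    ; lower-inhabited = 0ℚ , 0<xy
    ; upper-inhabited =
        let (u , uu) = upper-inhabited (real x)
            (v , uv) = upper-inhabited (real y)
        in u * v + 1ℚ , u , v , uu , uv , p<p+1 (u * v)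
    ; lower-closed    = λ p<q (r , s , 0<r , 0<s , lr , ls , q<rs) →
        r , s , 0<r , 0<s , lr , ls , <-trans p<q q<rs
    ; upper-closed    = λ p<q (u , v , uu , uv , uv<p) →
        u , v , uu , uv , <-trans uv<p p<q
    ; lower-open      = λ (r , s , 0<r , 0<s , lr , ls , p<rs) →
        let (q , p<q , q<rs) = <-dense p<rs
        in q , p<q , r , s , 0<r , 0<s , lr , ls , q<rs
    ; upper-open      = λ (u , v , uu , uv , uv<q) →
        let (p , uv<p , p<q) = <-dense uv<q
        in p , p<q , u , v , uu , uv , uv<p
    ; separated       = λ (r , s , 0<r , 0<s , lr , ls , p<rs) (u , v , uu , uv , uv<q) →
        <-trans p<rs (<-trans
          (*-mono-< 0<s (upper⁺ x uu) (separated (real x) lr uu) (separated (real y) ls uv))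
          uv<q)
    ; located         = loc
    }
  ; 0<real = 0<xy
  }
  where
  L U : ℚ → Set
  L q = ∃₂ λ r s → 0ℚ < r × 0ℚ < s × Lower (real x) r × Lower (real y) s × q < r * s
  U q = ∃₂ λ u v → Upper (real x) u × Upper (real y) v × u * v < q

  0<xy : L 0ℚ
  0<xy = let (r , 0<r , lr) = lower⁺ x
             (s , 0<s , ls) = lower⁺ y
         in r , s , 0<r , 0<s , lr , ls , *-pos {r} {s} 0<r 0<s

  loc⁺ : ∀ {p q} → 0ℚ < p → p < q → L p ⊎ U q
  loc⁺ {p} {q} 0<p p<q =
    let (r , u , 0<r , lr , uu , up<rq) = approx x 0<p p<q
        (t , p<tr , tu<q) = between {p} {q} 0<r (upper⁺ x uu)
          (subst₂ _<_ (*-comm u p) (*-comm r q) up<rq)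
        (s , s<t , p<sr) = reduce 0<r p<tr
        0<s = *-cancelʳ-< 0<r (subst (_< s * r) (sym (*-zeroˡ r)) (<-trans 0<p p<sr))
    in [ (λ ls → inj₁ (r , s , 0<r , 0<s , lr , ls , subst (p <_) (*-comm s r) p<sr))
       , (λ ut → inj₂ (u , t , uu , ut , subst (_< q) (*-comm t u) tu<q))
       ]′ (located (real y) s<t)

  loc : ∀ {p q} → p < q → L p ⊎ U q
  loc {p} p<q = case 0ℚ <? p of λ where
    (yes 0<p) → loc⁺ 0<p p<q
    (no  0≮p) → let (r , s , 0<r , 0<s , lr , ls , 0<rs) = 0<xy
                in inj₁ (r , s , 0<r , 0<s , lr , ls , ≤-<-trans (≮⇒≥ 0≮p) 0<rs)

_⁻¹ : ℝ⁺ → ℝ⁺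
x ⁻¹ = record
  { real = record
    { Lower           = L
    ; Upper           = U
    ; lower-inhabited = 0ℚ , 0<x⁻¹
    ; upper-inhabited =
        let (r , 0<r , lr) = lower⁺ x
            (q , qr≡2) = quotient (1ℚ + 1ℚ) 0<r
        in q , r , 0<r , lr ,
           subst (1ℚ <_) (sym qr≡2) (+-monoʳ-< 1ℚ (positive⁻¹ 1ℚ))
    ; lower-closed    = λ p<q (u , uu , qu<1) →
        u , uu , <-trans (*ʳ-< (upper⁺ x uu) p<q) qu<1
    ; upper-closed    = λ p<q (r , 0<r , lr , 1<pr) →
        r , 0<r , lr , <-trans 1<pr (*ʳ-< 0<r p<q)
    ; lower-open      = λ (u , uu , pu<1) →
        let (q , p<q , qu<1) = raise (upper⁺ x uu) pu<1
        in q , p<q , u , uu , qu<1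
    ; upper-open      = λ (r , 0<r , lr , 1<qr) →
        let (p , p<q , 1<pr) = reduce 0<r 1<qr
        in p , p<q , r , 0<r , lr , 1<pr
    ; separated       = λ {_} {q} (u , uu , pu<1) (r , 0<r , lr , 1<qr) →
        *-cancelʳ-< (upper⁺ x uu) (<-trans (<-trans pu<1 1<qr)
          (*ˡ-< {r = q} (factor-pos 0<r 1<qr) (separated (real x) lr uu)))
    ; located         = loc
    }
  ; 0<real = 0<x⁻¹
  }
  where
  L U : ℚ → Set
  L q = ∃ λ u → Upper (real x) u × q * u < 1ℚ
  U q = ∃ λ r → 0ℚ < r × Lower (real x) r × 1ℚ < q * r

  0<x⁻¹ : L 0ℚ
  0<x⁻¹ = let (u , uu) = upper-inhabited (real x)
          in u , uu , subst (_< 1ℚ) (sym (*-zeroˡ u)) (positive⁻¹ 1ℚ)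

  factor-pos : ∀ {q r} → 0ℚ < r → 1ℚ < q * r → 0ℚ < q
  factor-pos {q} {r} 0<r 1<qr = *-cancelʳ-< 0<r
    (subst (_< q * r) (sym (*-zeroˡ r)) (<-trans (positive⁻¹ 1ℚ) 1<qr))

  loc⁺ : ∀ {p q} → 0ℚ < p → p < q → L p ⊎ U q
  loc⁺ {p} {q} 0<p p<q =
    let 0<q = <-trans 0<p p<q
        (t , 1<tq , tp<1) = between {1ℚ} {1ℚ} 0<q 0<p (*ˡ-< (positive⁻¹ 1ℚ) p<q)
        (s , s<t , 1<sq) = reduce 0<q 1<tq
    in [ (λ ls → inj₂ (s , factor-pos 0<q 1<sq , ls , subst (1ℚ <_) (*-comm s q) 1<sq))
       , (λ ut → inj₁ (t , ut , subst (_< 1ℚ) (*-comm t p) tp<1))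
       ]′ (located (real x) s<t)

  loc : ∀ {p q} → p < q → L p ⊎ U q
  loc {p} p<q = case 0ℚ <? p of λ where
    (yes 0<p) → loc⁺ 0<p p<q
    (no  0≮p) →
      let (u , uu) = upper-inhabited (real x)
          0≤u = <⇒≤ (upper⁺ x uu)
          pu≤0 = subst (p * u ≤_) (*-zeroˡ u)
            (*-monoʳ-≤-nonNeg u {{nonNegative 0≤u}} (≮⇒≥ 0≮p))
      in inj₁ (u , uu , ≤-<-trans pu≤0 (positive⁻¹ 1ℚ))

_÷⁺_ : ℝ⁺ → ℝ⁺ → ℝ⁺
x ÷⁺ y = x *⁺ y ⁻¹

-- q < ∛ x  iff  q < r for some rational r > 0 with r ³ < x;
-- ∛ x < q  iff  u < q for some rational u > 0 with x < u ³.

∛_ : ℝ⁺ → ℝ⁺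
∛ x = record
  { real = record
    { Lower           = L
    ; Upper           = U
    ; lower-inhabited = 0ℚ , 0<∛x
    ; upper-inhabited =
        let (u , uu) = upper-inhabited (real x)
            0<u = upper⁺ x uu
        in u + 1ℚ + 1ℚ , u + 1ℚ , <-trans 0<u (p<p+1 u) ,
           upper-closed (real x) (p<cube[p+1] 0<u) uu , p<p+1 (u + 1ℚ)
    ; lower-closed    = λ p<q (r , 0<r , lr , q<r) → r , 0<r , lr , <-trans p<q q<r
    ; upper-closed    = λ p<q (u , 0<u , uu , u<p) → u , 0<u , uu , <-trans u<p p<q
    ; lower-open      = λ (r , 0<r , lr , p<r) →
        let (q , p<q , q<r) = <-dense p<r in q , p<q , r , 0<r , lr , q<r
    ; upper-open      = λ (u , 0<u , uu , u<q) →
        let (p , u<p , p<q) = <-dense u<q in p , p<q , u , 0<u , uu , u<p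
    ; separated       = λ (r , 0<r , lr , p<r) (u , 0<u , uu , u<q) →
        <-trans p<r (<-trans (cube-cancel-< 0<u (separated (real x) lr uu)) u<q)
    ; located         = loc
    }
  ; 0<real = 0<∛x
  }
  where
  L U : ℚ → Set
  L q = ∃ λ r → 0ℚ < r × Lower (real x) (cube r) × q < r
  U q = ∃ λ u → 0ℚ < u × Upper (real x) (cube u) × u < q

  0<∛x : L 0ℚ
  0<∛x =
    let (r , 0<r , lr) = lower⁺ x
    in case r <? 1ℚ of λ where
      (yes r<1) → r , 0<r , lower-closed (real x) (cube[p]<p 0<r r<1) lr , 0<r
      (no  r≮1) → ½ , positive⁻¹ ½ ,
        lower-closed (real x) (<-≤-trans cube[½]<1 (≮⇒≥ r≮1)) lr , positive⁻¹ ½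

  loc : ∀ {p q} → p < q → L p ⊎ U q
  loc {p} p<q = case 0ℚ ≤? p of λ where
    (yes 0≤p) →
      let (t , p<t , t<q) = <-dense p<q
          (s , p<s , s<t) = <-dense p<t
          0<s = ≤-<-trans 0≤p p<s
      in [ (λ ls → inj₁ (s , 0<s , ls , p<s))
         , (λ ut → inj₂ (t , <-trans 0<s s<t , ut , t<q))
         ]′ (located (real x) (cube-mono-< 0<s s<t))
    (no  0≰p) → let (r , 0<r , lr , _) = 0<∛x
                in inj₁ (r , 0<r , lr , <-trans (≰⇒> 0≰p) 0<r)

-- The initial values are positive: a zero term makes a ratio of
-- consecutive terms undefined, and with real cube roots the signs
-- -, +, + lead to infinitely many sign changes.

g⁽³⁾ : (a b c : ℝ⁺) (ε : ℕ) .{{_ : ℕ.NonZero ε}} → ℕ → ℝ⁺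
g⁽³⁾ a b c ε 0 = a
g⁽³⁾ a b c ε 1 = b
g⁽³⁾ a b c ε 2 = c
g⁽³⁾ a b c ε (suc (suc (suc n))) =
  fromℕ⁺ ε *⁺ ∛ (g⁽³⁾ a b c ε (suc (suc n)) *⁺ g⁽³⁾ a b c ε (suc n) *⁺ g⁽³⁾ a b c ε n)

{-# OPTIONS --safe #-}
-- Let ρₙ = gₙ₊₁ / gₙ.  Then ρₙ₊₂³ = 1 / (ρₙ₊₁² ρₙ), and applying this twice
-- gives ρₙ₊₃⁹ = ρₙ₊₁ ρₙ².  Hence bounds 1/s ≤ ρ ≤ s on two consecutive
-- ratios persist for ever, and if s = t³ they improve to 1/t ≤ ρ ≤ t three
-- steps later.  Starting from some bound M for ρ₀ and ρ₁ and given r > 1, the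
-- k-fold cube of r exceeds M for some k, so that 1/r ≤ ρₙ ≤ r for n ≥ 3k.
-- All this is carried out on rational upper bounds of the terms.
module Submission where

open import Data.Nat using (ℕ; suc)
open import Defs

open import Data.Nat.Base as ℕ using (zero)
import Data.Nat.Properties as ℕ
open import Data.Product using (∃; ∃₂; _×_; _,_; proj₁; proj₂)
open import Data.Rational
open import Data.Rational.Properties
open import Data.Rational.Solver using (module +-*-Solver)
open import Data.Sum using (_⊎_; inj₁; inj₂; [_,_]′)
open import Relation.Binary.PropositionalEquality
open import Relation.Nullary using (¬_; yes; no; contradiction)

open ℝ
open +-*-Solver

-- Order and cancellation for products, squares and cubes of rationals.

*ʳ-≤ : ∀ {p q r} → 0ℚ < r → p ≤ q → p * r ≤ q * r
*ʳ-≤ {r = r} 0<r = *-monoʳ-≤-nonNeg r {{pos⇒nonNeg r {{positive 0<r}}}}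

*ˡ-≤ : ∀ {p q r} → 0ℚ < r → p ≤ q → r * p ≤ r * q
*ˡ-≤ {r = r} 0<r = *-monoˡ-≤-nonNeg r {{pos⇒nonNeg r {{positive 0<r}}}}

*-cancelˡ-≤ : ∀ {p q r} → 0ℚ < r → r * p ≤ r * q → p ≤ q
*-cancelˡ-≤ {r = r} 0<r = *-cancelˡ-≤-pos r {{positive 0<r}}

*-mono-≤ : ∀ {p q r s} → 0ℚ < r → 0ℚ < q → p ≤ q → r ≤ s → p * r ≤ q * s
*-mono-≤ 0<r 0<q p≤q r≤s = ≤-trans (*ʳ-≤ 0<r p≤q) (*ˡ-≤ 0<q r≤s)

cube-pos : ∀ {p} → 0ℚ < p → 0ℚ < cube p
cube-pos 0<p = *-pos (*-pos 0<p 0<p) 0<p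

cube-* : ∀ p q → cube (p * q) ≡ cube p * cube q
cube-* = solve 2 (λ p q → p :* q :* (p :* q) :* (p :* q) := p :* p :* p :* (q :* q :* q)) refl

<⇒≱ : ∀ {p q} → p < q → ¬ q ≤ p
<⇒≱ p<q q≤p = <-irrefl refl (<-≤-trans p<q q≤p)

square-cancel-≤ : ∀ {p q} → 0ℚ < q → p * p ≤ q * q → p ≤ q
square-cancel-≤ 0<q p²≤q² = ≮⇒≥ λ q<p →
  <⇒≱ (*-mono-< 0<q (<-trans 0<q q<p) q<p q<p) p²≤q²

cube-cancel-≤ : ∀ {p q} → 0ℚ < q → cube p ≤ cube q → p ≤ q
cube-cancel-≤ 0<q p³≤q³ = ≮⇒≥ λ q<p → <⇒≱ (cube-mono-< 0<q q<p) p³≤q³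

-- Unboundedness of iterated cubes.

cube^ : ℕ → ℚ → ℚ
cube^ zero    r = r
cube^ (suc k) r = cube (cube^ k r)

-- p³ ≥ p² = p + (p - 1) p ≥ p + (p - 1) ≥ p + δ. Iterated cubes therefore grow at least linearly,
-- which suffices for the Archimedean property.
cube-growth : ∀ {δ p} → 0ℚ < δ → 1ℚ + δ ≤ p → δ + p ≤ cube p
cube-growth {δ} {p} 0<δ 1+δ≤p = begin
  δ + p             ≤⟨ +-monoˡ-≤ p δ≤p-1 ⟩
  p - 1ℚ + p        ≡⟨ expand p ⟩
  1ℚ * p + (p - 1ℚ) * 1ℚ
    ≤⟨ +-monoʳ-≤ (1ℚ * p) (*-mono-≤ (positive⁻¹ 1ℚ) 0<p-1 ≤-refl 1≤p) ⟩
  1ℚ * p + (p - 1ℚ) * p ≡⟨ collect p ⟩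
  p * p             ≡⟨ sym (*-identityʳ (p * p)) ⟩
  p * p * 1ℚ        ≤⟨ *ˡ-≤ (*-pos 0<p 0<p) 1≤p ⟩
  p * p * p         ∎
  where
  open ≤-Reasoning
  1≤p : 1ℚ ≤ p
  1≤p = ≤-trans (subst (_≤ 1ℚ + δ) (+-identityʳ 1ℚ) (+-monoʳ-≤ 1ℚ (<⇒≤ 0<δ))) 1+δ≤p
  0<p : 0ℚ < p
  0<p = <-≤-trans (positive⁻¹ 1ℚ) 1≤p
  δ≤p-1 : δ ≤ p - 1ℚ
  δ≤p-1 = subst (_≤ p - 1ℚ)
    (solve 1 (λ δ → con 1ℚ :+ δ :- con 1ℚ := δ) refl δ) (+-monoˡ-≤ (- 1ℚ) 1+δ≤p)
  0<p-1 : 0ℚ < p - 1ℚ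
  0<p-1 = <-≤-trans 0<δ δ≤p-1
  expand : ∀ p → p - 1ℚ + p ≡ 1ℚ * p + (p - 1ℚ) * 1ℚ
  expand = solve 1 (λ p → p :- con 1ℚ :+ p := con 1ℚ :* p :+ (p :- con 1ℚ) :* con 1ℚ) refl
  collect : ∀ p → 1ℚ * p + (p - 1ℚ) * p ≡ p * p
  collect = solve 1 (λ p → con 1ℚ :* p :+ (p :- con 1ℚ) :* p := p :* p) refl

cube^-growth : ∀ {δ} → 0ℚ < δ → ∀ k → k · δ + (1ℚ + δ) ≤ cube^ k (1ℚ + δ)
cube^-growth {δ} 0<δ zero    = ≤-reflexive (+-identityˡ (1ℚ + δ))
cube^-growth {δ} 0<δ (suc k) = begin
  δ + k · δ + (1ℚ + δ)   ≡⟨ +-assoc δ (k · δ) (1ℚ + δ) ⟩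
  δ + (k · δ + (1ℚ + δ)) ≤⟨ +-monoʳ-≤ δ (cube^-growth 0<δ k) ⟩
  δ + cube^ k (1ℚ + δ)   ≤⟨ cube-growth 0<δ (≤-trans 1+δ≤ (cube^-growth 0<δ k)) ⟩
  cube^ (suc k) (1ℚ + δ) ∎
  where
  open ≤-Reasoning
  ·-nonNeg : ∀ n → 0ℚ ≤ n · δ
  ·-nonNeg zero    = ≤-refl
  ·-nonNeg (suc n) = +-mono-≤ (<⇒≤ 0<δ) (·-nonNeg n)
  1+δ≤ : 1ℚ + δ ≤ k · δ + (1ℚ + δ)
  1+δ≤ = subst (_≤ k · δ + (1ℚ + δ)) (+-identityˡ (1ℚ + δ)) (+-monoˡ-≤ (1ℚ + δ) (·-nonNeg k))

cube^-unbounded : ∀ {r} M → 1ℚ < r → ∃ λ k → M ≤ cube^ k r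
cube^-unbounded {r} M 1<r =
  let (k , M≤kδ) = archimedean M 0<δ
  in k , subst (λ r → M ≤ cube^ k r) 1+δ≡r (≤-trans M≤kδ (≤-trans
       (subst (_≤ k · δ + (1ℚ + δ)) (+-identityʳ (k · δ))
         (+-monoʳ-≤ (k · δ) (<⇒≤ (<-trans 0<δ (subst (_< 1ℚ + δ) (+-identityˡ δ)
           (+-monoˡ-< δ (positive⁻¹ 1ℚ)))))))
       (cube^-growth 0<δ k)))
  where
  δ = r - 1ℚ
  0<δ : 0ℚ < δ
  0<δ = +-monoˡ-< (- 1ℚ) 1<r
  1+δ≡r : 1ℚ + δ ≡ r
  1+δ≡r = solve 1 (λ r → con 1ℚ :+ (r :- con 1ℚ) := r) refl r

cube^-pos : ∀ {r} k → 0ℚ < r → 0ℚ < cube^ k r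
cube^-pos zero    0<r = 0<r
cube^-pos (suc k) 0<r = cube-pos (cube^-pos k 0<r)

-- Positive reals and their means through rational upper bounds.

Above : ℝ⁺ → ℚ → Set
Above x = Upper (real x)

above-pos : ∀ x {u} → Above x u → 0ℚ < u
above-pos x = L⁺.upper⁺ x

above-≤ : ∀ x {u v} → u ≤ v → Above x u → Above x v
above-≤ x {u} u≤v xu =
  let (w , w<u , xw) = upper-open (real x) xu
  in upper-closed (real x) (<-≤-trans w<u u≤v) xw

above-⊓ : ∀ x {u v} → Above x u → Above x v → Above x (u ⊓ v)
above-⊓ x {u} {v} xu xv =
  [ (λ e → subst (Above x) (sym e) xu) , (λ e → subst (Above x) (sym e) xv) ]′ (⊓-sel u v)

-- Whether w lies above x need not be decidable, but comparing w with a known bound u is. This makes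
-- room for arguments by contradiction about bounds.
above⊎≤ : ∀ x {u} w → Above x u → Above x w ⊎ w ≤ u
above⊎≤ x {u} w xu with w ≤? u
... | yes w≤u = inj₂ w≤u
... | no  w≰u = inj₁ (upper-closed (real x) (≰⇒> w≰u) xu)

-- The factor ε = 1 of the recurrence is kept, so that terms of the sequence
-- are means definitionally.
mean : ℝ⁺ → ℝ⁺ → ℝ⁺ → ℝ⁺
mean x y z = fromℕ⁺ 1 *⁺ ∛ (x *⁺ y *⁺ z)

-- Together with `above-mean⁺` this reduces estimates of means to polynomial inequalities between
-- rationals.
above-mean⁻ : ∀ x y z {v} → Above (mean x y z) v →
  ∃ λ p → ∃₂ λ q r → Above x p × Above y q × Above z r × p * q * r < cube v
above-mean⁻ x y z {v} (t , u , 1<t , (w , 0<w , (pq , r , (p , q , xp , yq , pq<) , zr , pqr<) , w<u) , tu<v) =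
  p , q , r , xp , yq , zr ,
  <-trans (*ʳ-< (above-pos z zr) pq<) (<-trans pqr< (cube-mono-< 0<w (<-trans w<u u<v)))
  where
  u<v : u < v
  u<v = <-trans (subst (_< t * u) (*-identityˡ u) (*ʳ-< (<-trans 0<w w<u) 1<t)) tu<v

above-mean⁺ : ∀ x y z {p q r w v} → Above x p → Above y q → Above z r →
  0ℚ < w → p * q * r ≤ cube w → w < v → Above (mean x y z) v
above-mean⁺ x y z {p} {q} {r} xp yq zr 0<w pqr≤ w<v =
  -- The cuts of products need strict inequalities; lowering r to r′ makes room for s above p q.
  let (r′ , r′<r , zr′) = upper-open (real z) zr
      (s , pq<s , sr′<) = raise (above-pos z zr′)
        (<-≤-trans (*ˡ-< (*-pos (above-pos x xp) (above-pos y yq)) r′<r) pqr≤)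
      -- The gap from w to v is split between the cube root (m) and the scaling factor 1 (t).
      (m , w<m , m<v) = <-dense w<v
      (t , 1<t , tm<v) = raise {1ℚ} (<-trans 0<w w<m) (subst (_< _) (sym (*-identityˡ m)) m<v)
  in t , m , 1<t , (_ , 0<w , (s , r′ , (p , q , xp , yq , pq<s) , zr′ , sr′<) , w<m) , tm<v

-- Closeness up to a rational factor, and its persistence.

infix 4 _≤[_]_

-- y ≤ s x, in terms of upper bounds only
_≤[_]_ : ℝ⁺ → ℚ → ℝ⁺ → Set
y ≤[ s ] x = ∀ {u} → Above x u → Above y (s * u)

-- Encodes 1 / s ≤ y / x ≤ s without division.
Near : ℚ → ℝ⁺ → ℝ⁺ → Set
Near s x y = x ≤[ s ] y × y ≤[ s ] x

≤[]-weaken : ∀ x y {s t} → s ≤ t → x ≤[ s ] y → x ≤[ t ] y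
≤[]-weaken x y s≤t x≤y yu = above-≤ x (*ʳ-≤ (above-pos y yu) s≤t) (x≤y yu)

near-weaken : ∀ x y {s t} → s ≤ t → Near s x y → Near t x y
near-weaken x y s≤t (xy , yx) = ≤[]-weaken x y s≤t xy , ≤[]-weaken y x s≤t yx

-- For x < u and 0 < l < y take s = u / l: every v above y gives x < u = s l < s v.
≤[]-exists : ∀ x y → ∃ λ s → x ≤[ s ] y
≤[]-exists x y =
  let (u , xu) = upper-inhabited (real x)
      (l , 0<l , yl) = L⁺.lower⁺ y
      (s , sl≡u) = quotient u 0<l
      0<s = *-cancelʳ-< {q = s} 0<l (subst₂ _<_ (sym (*-zeroˡ l)) (sym sl≡u) (above-pos x xu))
  in s , λ {v} yv → upper-closed (real x)
       (subst (_< s * v) sl≡u (*ˡ-< 0<s (separated (real y) yl yv))) xu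

near-exists : ∀ x y → ∃ λ s → Near s x y
near-exists x y =
  let (s , xy) = ≤[]-exists x y
      (t , yx) = ≤[]-exists y x
  in s ⊔ t , ≤[]-weaken x y (p≤p⊔q s t) xy , ≤[]-weaken y x (p≤q⊔p s t) yx

-- If w³ = z y x, then (w / z)³ = (y / z) (x / z). The first factor lies between 1 / s and s, the
-- second between 1 / s² and s², so w / z stays between 1 / s and s.
near-mean : ∀ {s} x y z → 0ℚ < s → Near s x y → Near s y z → Near s z (mean z y x)
near-mean {s} x y z 0<s (xy , yx) (yz , zy) = z≤ , ≤z
  where
  ≤z : mean z y x ≤[ s ] z
  ≤z {v} zv =
    let (w , w<v , zw) = upper-open (real z) zv
        yw = yz zw
    in above-mean⁺ z y x zw yw (xy yw) (above-pos y yw) (≤-reflexive (regroup s w)) (*ˡ-< 0<s w<v)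
    where
    regroup : ∀ s w → w * (s * w) * (s * (s * w)) ≡ cube (s * w)
    regroup = solve 2 (λ s w → w :* (s :* w) :* (s :* (s :* w)) := s :* w :* (s :* w) :* (s :* w)) refl
  z≤ : z ≤[ s ] mean z y x
  z≤ {v} mv with above-mean⁻ z y x mv
  ... | p , q , r , zp , yq , xr , pqr<v³
    -- All of p, s q and s² r are above z. If none of them is less than s v, multiplying gives v³ ≤
    -- p q r, a contradiction.
    with above⊎≤ z (s * v) zp | above⊎≤ z (s * v) (zy yq) | above⊎≤ z (s * v) (zy (yx xr))
  ... | inj₁ zsv | _ | _ = zsv
  ... | inj₂ _ | inj₁ zsv | _ = zsv
  ... | inj₂ _ | inj₂ _ | inj₁ zsv = zsv
  ... | inj₂ sv≤p | inj₂ sv≤sq | inj₂ sv≤ssr = contradiction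
    (*-cancelˡ-≤ 0<s (subst₂ _≤_ (left s v) (right s p q r)
      (*-mono-≤ 0<v (*-pos (above-pos z zp) (above-pos y yq))
        (*-mono-≤ 0<v (above-pos z zp) sv≤p (*-cancelˡ-≤ 0<s sv≤sq))
        (*-cancelˡ-≤ 0<s sv≤ssr)))) (<⇒≱ pqr<v³)
    where
    0<v = above-pos (mean z y x) mv
    left : ∀ s v → s * v * v * v ≡ s * cube v
    left = solve 2 (λ s v → s :* v :* v :* v := s :* (v :* v :* v)) refl
    right : ∀ s p q r → p * q * (s * r) ≡ s * (p * q * r)
    right = solve 4 (λ s p q r → p :* q :* (s :* r) := s :* (p :* q :* r)) refl

-- Contraction of the factor from s³ to s.

-- Here p, q, r, v bound z, y, x and their mean. With S = s³, (p q)³ ≤ (p q)² S³ r² = S³ (p q r)² ≤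
-- S³ v⁶, hence p q ≤ S v².
contract-upper : ∀ {s p q r v} → 0ℚ < s → 0ℚ < p → 0ℚ < q → 0ℚ < r → 0ℚ < v →
  p ≤ cube s * (cube s * r) → q ≤ cube s * r → p * q * r ≤ cube v →
  v * p * q ≤ cube (s * v)
contract-upper {s} {p} {q} {r} {v} 0<s 0<p 0<q 0<r 0<v p≤ q≤ pqr≤ = begin
  v * p * q         ≡⟨ *-assoc v p q ⟩
  v * (p * q)       ≤⟨ *ˡ-≤ 0<v (cube-cancel-≤ (*-pos 0<S (*-pos 0<v 0<v)) pq³≤) ⟩
  v * (S * (v * v)) ≡⟨ solve 2 (λ s v → v :* (s :* s :* s :* (v :* v)) :=
                         s :* v :* (s :* v) :* (s :* v)) refl s v ⟩
  cube (s * v)      ∎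
  where
  open ≤-Reasoning
  S = cube s
  0<S = cube-pos 0<s
  0<pq = *-pos 0<p 0<q
  0<pqr = *-pos 0<pq 0<r
  pq³≤ : cube (p * q) ≤ cube (S * (v * v))
  pq³≤ = begin
    p * q * (p * q) * (p * q)
      ≤⟨ *ˡ-≤ (*-pos 0<pq 0<pq)
           (*-mono-≤ 0<q (*-pos 0<S (*-pos 0<S 0<r)) p≤ q≤) ⟩
    p * q * (p * q) * (S * (S * r) * (S * r))
      ≡⟨ solve 3 (λ S w r → w :* w :* (S :* (S :* r) :* (S :* r)) :=
           S :* S :* S :* (w :* r :* (w :* r))) refl S (p * q) r ⟩
    cube S * (p * q * r * (p * q * r))
      ≤⟨ *ˡ-≤ (cube-pos 0<S) (*-mono-≤ 0<pqr (cube-pos 0<v) pqr≤ pqr≤) ⟩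
    cube S * (cube v * cube v)
      ≡⟨ solve 2 (λ S v → S :* S :* S :* (v :* v :* v :* (v :* v :* v)) :=
           S :* (v :* v) :* (S :* (v :* v)) :* (S :* (v :* v))) refl S v ⟩
    cube (S * (v * v)) ∎

-- The first and third inequalities give s p q ≤ v². Then (p q²)² ≤ p² q³ (s³ p) = (s p q)³ ≤ v⁶,
-- hence p q² ≤ v³.
contract-lower : ∀ {s o p q v} → 0ℚ < s → 0ℚ < p → 0ℚ < q → 0ℚ < v →
  s * v ≤ o → q ≤ cube s * p → o * p * q ≤ cube v →
  p * q * (cube s * q) ≤ cube (s * v)
contract-lower {s} {o} {p} {q} {v} 0<s 0<p 0<q 0<v sv≤o q≤ opq≤ = begin
  p * q * (S * q)   ≡⟨ solve 3 (λ S w q → w :* (S :* q) := S :* (w :* q)) refl S (p * q) q ⟩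
  S * (p * q * q)   ≤⟨ *ˡ-≤ 0<S (square-cancel-≤ (cube-pos 0<v) pqq²≤) ⟩
  S * cube v        ≡⟨ sym (cube-* s v) ⟩
  cube (s * v)      ∎
  where
  open ≤-Reasoning
  S = cube s
  0<S = cube-pos 0<s
  0<pq = *-pos 0<p 0<q
  spq≤v² : s * (p * q) ≤ v * v
  spq≤v² = *-cancelˡ-≤ 0<v (begin
    v * (s * (p * q)) ≡⟨ solve 4 (λ v s p q → v :* (s :* (p :* q)) := s :* v :* p :* q) refl v s p q ⟩
    s * v * p * q     ≤⟨ *ʳ-≤ 0<q (*ʳ-≤ 0<p sv≤o) ⟩
    o * p * q         ≤⟨ opq≤ ⟩
    v * v * v         ≡⟨ *-assoc v v v ⟩
    v * (v * v)       ∎)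
  cube-mono-≤ : ∀ {a b} → 0ℚ < a → 0ℚ < b → a ≤ b → cube a ≤ cube b
  cube-mono-≤ 0<a 0<b a≤b = *-mono-≤ 0<a (*-pos 0<b 0<b) (*-mono-≤ 0<a 0<b a≤b a≤b) a≤b
  pqq²≤ : p * q * q * (p * q * q) ≤ cube v * cube v
  pqq²≤ = begin
    p * q * q * (p * q * q)
      ≡⟨ solve 2 (λ w q → w :* q :* (w :* q) := w :* w :* q :* q) refl (p * q) q ⟩
    p * q * (p * q) * q * q
      ≤⟨ *ˡ-≤ (*-pos (*-pos 0<pq 0<pq) 0<q) q≤ ⟩
    p * q * (p * q) * q * (S * p)
      ≡⟨ solve 3 (λ s p q → p :* q :* (p :* q) :* q :* (s :* s :* s :* p) :=
           s :* (p :* q) :* (s :* (p :* q)) :* (s :* (p :* q))) refl s p q ⟩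
    cube (s * (p * q))
      ≤⟨ cube-mono-≤ (*-pos 0<s 0<pq) (*-pos 0<v 0<v) spq≤v² ⟩
    cube (v * v)
      ≡⟨ cube-* v v ⟩
    cube v * cube v ∎

near-contract : ∀ {s} x y z → 0ℚ < s → Near (cube s) x y → Near (cube s) y z →
  Near s (mean z y x) (mean (mean z y x) z y)
near-contract {s} x y z 0<s (xy , yx) (yz , zy) = w≤ , ≤w
  where
  S = cube s
  w = mean z y x
  ≤w : mean w z y ≤[ s ] w
  ≤w {v} wv =
    let (v′ , v′<v , wv′) = upper-open (real w) wv
        (p , q , r , zp , yq , xr , pqr<) = above-mean⁻ z y x wv′
        -- The bounds p, q, r are unrelated to each other. Capping p and q by what closeness derives
        -- from r supplies the hypotheses of `contract-upper` and only lowers the product.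
        p′ = p ⊓ S * (S * r)
        q′ = q ⊓ S * r
        zp′ = above-⊓ z zp (zy (yx xr))
        yq′ = above-⊓ y yq (yx xr)
        0<p′ = above-pos z zp′
        0<q′ = above-pos y yq′
        0<r = above-pos x xr
        0<v′ = above-pos w wv′
        pqr≤ = ≤-trans (*ʳ-≤ 0<r (*-mono-≤ 0<q′ (above-pos z zp) (p⊓q≤p p (S * (S * r))) (p⊓q≤p q (S * r))))
                 (<⇒≤ pqr<)
    in above-mean⁺ w z y wv′ zp′ yq′ (*-pos 0<s 0<v′)
         (contract-upper 0<s 0<p′ 0<q′ 0<r 0<v′
           (p⊓q≤q p (S * (S * r))) (p⊓q≤q q (S * r)) pqr≤)
         (*ˡ-< 0<s v′<v)
  w≤ : w ≤[ s ] mean w z y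
  w≤ {v} mv with upper-open (real (mean w z y)) mv
  ... | v′ , v′<v , mv′ with above-mean⁻ w z y mv′
  -- If o < s v′, then s v′ is above w already; otherwise `contract-lower` applies.
  ... | o , p , q , wo , zp , yq , opq< with above⊎≤ w (s * v′) wo
  ... | inj₁ wsv′ = upper-closed (real w) (*ˡ-< 0<s v′<v) wsv′
  ... | inj₂ sv′≤o =
    let q′ = q ⊓ S * p
        yq′ = above-⊓ y yq (yz zp)
        0<p = above-pos z zp
        0<q′ = above-pos y yq′
        0<v′ = above-pos (mean w z y) mv′
        opq≤ = ≤-trans (*ˡ-≤ (*-pos (above-pos w wo) 0<p) (p⊓q≤p q (S * p))) (<⇒≤ opq<)
    in above-mean⁺ z y x zp yq′ (xy yq′) (*-pos 0<s 0<v′)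
         (contract-lower 0<s 0<p 0<q′ 0<v′ sv′≤o (p⊓q≤q q (S * p)) opq≤)
         (*ˡ-< 0<s v′<v)

-- From closeness to the limit of the ratios.

-- The slack t > 1 pays for enclosing a term between rationals l and u with u < l t, so that s u < s
-- t l.
ratio-near-1 : ∀ {s t ε} x y → 0ℚ < ε → 0ℚ < s → 1ℚ < t → s * t < 1ℚ + ε → Near s x y →
  ∣ real (y ÷⁺ x) - 1ℝ ∣< ε
ratio-near-1 {s} {t} {ε} x y 0<ε 0<s 1<t st<1+ε (xy , yx) = ratio<1+ε , 1<ratio+ε
  where
  κ = s * t
  0<κ : 0ℚ < κ
  0<κ = *-pos 0<s (<-trans (positive⁻¹ 1ℚ) 1<t)
  spread : ∀ {l u} → u * 1ℚ < l * t → s * u < κ * l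
  spread {l} {u} u<lt = subst₂ _<_ (cong (s *_) (*-identityʳ u))
    (solve 3 (λ s t l → s :* (l :* t) := s :* t :* l) refl s t l) (*ˡ-< 0<s u<lt)

  ratio<1+ε : real (y ÷⁺ x) <ℝ 1ℝ +ℚ ε
  ratio<1+ε =
    let (l , u , 0<l , xl , xu , u<lt) = L⁺.approx x (positive⁻¹ 1ℚ) 1<t
        su<κl = spread u<lt
        ysu = yx xu
        (m , κ<m , m<1+ε) = <-dense st<1+ε
        (w , 1<wl , wsu<m) = between {1ℚ} {m} {l} {s * u} 0<l (above-pos y ysu)
          (subst (_< m * l) (sym (*-identityˡ (s * u))) (<-trans su<κl (*ʳ-< 0<l κ<m)))
    in m , (s * u , w , ysu , (l , 0<l , xl , 1<wl) , subst (_< m) (*-comm w (s * u)) wsu<m) ,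
       subst (m - ε <_) (+-‿-cancel 1ℚ ε) (+-monoˡ-< (- ε) m<1+ε)

  1<ratio+ε : 1ℝ <ℝ real (y ÷⁺ x) +ℚ ε
  1<ratio+ε =
    let (l , u , 0<l , yl , yu , u<lt) = L⁺.approx y (positive⁻¹ 1ℚ) 1<t
        xsu = xy yu
        0<su = above-pos x xsu
        (m , 1-ε<m , 0<m , mκ<1) = shrink
        m*su<l = *-cancelʳ-< 0<κ (<-trans
          (subst₂ _<_ (swap m κ (s * u)) (*-identityˡ (s * u)) (*ʳ-< 0<su mκ<1))
          (subst (s * u <_) (*-comm κ l) (spread u<lt)))
        (w , m<wl , wsu<1) = between {m} {1ℚ} {l} {s * u} 0<l 0<su
          (subst (m * (s * u) <_) (sym (*-identityˡ l)) m*su<l)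
        0<w = *-cancelʳ-< 0<l (subst (_< w * l) (sym (*-zeroˡ l)) (<-trans 0<m m<wl))
    in m + ε , subst (_< m + ε) (-‿+-cancel 1ℚ ε) (+-monoˡ-< ε 1-ε<m) ,
       (l , w , 0<l , 0<w , yl , (s * u , xsu , wsu<1) ,
        subst₂ _<_ (sym (+-‿-cancel m ε)) (*-comm w l) m<wl)
    where
    swap : ∀ m κ a → m * κ * a ≡ m * a * κ
    swap = solve 3 (λ m κ a → m :* κ :* a := m :* a :* κ) refl
    shrink : ∃ λ m → 1ℚ - ε < m × 0ℚ < m × m * κ < 1ℚ
    -- If 1 - ε > 0, then (1 - ε) κ < 1 - ε² < 1 leaves room for m above 1 - ε. Otherwise any small
    -- m > 0 works; positivity is needed for lower bounds of a product.
    shrink with 0ℚ <? 1ℚ - ε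
    ... | yes 0<1-ε =
      let (m , 1-ε<m , mκ<1) = raise {b = 1ℚ} 0<κ (<-trans (*ˡ-< 0<1-ε st<1+ε) 1-ε²<1)
      in m , 1-ε<m , <-trans 0<1-ε 1-ε<m , mκ<1
      where
      1-ε²<1 : (1ℚ - ε) * (1ℚ + ε) < 1ℚ
      1-ε²<1 = subst₂ _<_ (+-identityʳ _)
        (solve 1 (λ ε → (con 1ℚ :- ε) :* (con 1ℚ :+ ε) :+ ε :* ε := con 1ℚ) refl ε)
        (+-monoʳ-< ((1ℚ - ε) * (1ℚ + ε)) (*-pos 0<ε 0<ε))
    ... | no 0≮1-ε =
      let (m , 0<m , mκ<1) = raise {0ℚ} {1ℚ} 0<κ
            (subst (_< 1ℚ) (sym (*-zeroˡ κ)) (positive⁻¹ 1ℚ))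
      in m , ≤-<-trans (≮⇒≥ 0≮1-ε) 0<m , 0<m , mκ<1

theorem2p1 : (a b c : ℝ⁺) →
    lim (λ n → real (g⁽³⁾ a b c 1 (suc n) ÷⁺ g⁽³⁾ a b c 1 n)) ≈ 1ℝ
theorem2p1 a b c ε 0<ε =
  -- Two factors above 1 with product below 1 + ε: s will bound the ratios, t is the slack for
  -- `ratio-near-1`.
  let (t , 1<t , t1<1+ε) = raise {1ℚ} {1ℚ + ε} (positive⁻¹ 1ℚ)
        (subst (_< 1ℚ + ε) (+-identityʳ 1ℚ) (+-monoʳ-< 1ℚ 0<ε))
      (s , 1<s , st<1+ε) = raise {1ℚ} {1ℚ + ε} (<-trans (positive⁻¹ 1ℚ) 1<t)
        (subst (_< 1ℚ + ε) (*-comm t 1ℚ) t1<1+ε)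
      0<s = <-trans (positive⁻¹ 1ℚ) 1<s
      (M , ab) = near-exists a b
      (M′ , bc) = near-exists b c
      (k , M⊔M′≤) = cube^-unbounded (M ⊔ M′) 1<s
      near₀ = near-weaken a b (≤-trans (p≤p⊔q M M′) M⊔M′≤) ab ,
              near-weaken b c (≤-trans (p≤q⊔p M M′) M⊔M′≤) bc
      (N , nearN) = descend k 0 0<s near₀
  in N , λ n N≤n → ratio-near-1 (g n) (g (suc n)) 0<ε 0<s 1<t st<1+ε
       (proj₁ (persist 0<s N≤n nearN))
  where
  g : ℕ → ℝ⁺
  g = g⁽³⁾ a b c 1

  -- The ratios obey a recurrence of order two, so two consecutive ones form its state.
  Near₂ : ℚ → ℕ → Set
  Near₂ s n = Near s (g n) (g (suc n)) × Near s (g (suc n)) (g (2 ℕ.+ n))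

  step : ∀ {s} n → 0ℚ < s → Near₂ s n → Near₂ s (suc n)
  step n 0<s (xy , yz) = yz , near-mean (g n) (g (suc n)) (g (2 ℕ.+ n)) 0<s xy yz

  persist : ∀ {s m n} → 0ℚ < s → m ℕ.≤ n → Near₂ s m → Near₂ s n
  persist {s} {m} 0<s m≤n near = go (ℕ.≤⇒≤′ m≤n)
    where
    go : ∀ {n} → m ℕ.≤′ n → Near₂ s n
    go ℕ.≤′-refl                = near
    go (ℕ.≤′-step {n = n} m≤′n) = step n 0<s (go {n} m≤′n)

  contract : ∀ {s} n → 0ℚ < s → Near₂ (cube s) n → Near₂ s (3 ℕ.+ n)
  contract n 0<s near@(xy , yz) =
    near-contract (g n) (g (1 ℕ.+ n)) (g (2 ℕ.+ n)) 0<s xy yz ,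
    -- The second ratio needs the hypotheses shifted by one index, and these hold by persistence of
    -- the weaker bound.
    near-contract (g (1 ℕ.+ n)) (g (2 ℕ.+ n)) (g (3 ℕ.+ n)) 0<s yz
      (proj₂ (step n (cube-pos 0<s) near))

  -- Every three indices undo one cubing, so the index reached is 3 k + n.
  descend : ∀ {s} k n → 0ℚ < s → Near₂ (cube^ k s) n → ∃ (Near₂ s)
  descend zero    n 0<s near = n , near
  descend (suc k) n 0<s near = descend k (3 ℕ.+ n) 0<s (contract n (cube^-pos k 0<s) near)
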